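{- Let $G$ be a digraph with $n$ vertices and minimum outdegree $\delta>72\log(3n)$. Then $G$ has a majority $3$-colouring. Moreover, the $3$-colouring can be chosen so that, for every vertex $v$ of $G$ and every colour $c\in\{1,2,3\}$, at most half the out-neighbours of $v$ receive colour $c$.
   Context: Digraphs are finite, with no loops and no parallel arcs (a pair of oppositely directed arcs $uv$ and $vu$ is allowed). $\log$ denotes the natural logarithm. A majority $3$-colouring of a digraph is a function assigning each vertex one of three colours such that, for each vertex $v$, at most half the out-neighbours of $v$ receive the same colour as $v$. -}

module Defs where

open import Data.Fin.Base using (Fin)
import Data.Fin.Properties as Fin
open import Data.Fin.Subset using (Subset; _∉_; _∩_; ∣_∣)
open import Data.Integer.Base as ℤ using (+_; -[1+_]; 1ℤ)
import Data.Integer.Properties as ℤ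
open import Data.Nat.Base as ℕ using (ℕ; zero; suc)
import Data.Nat.Properties as ℕ
import Data.Nat.Tactic.RingSolver as ℕ-Solver
open import Data.Product.Base using (∃-syntax; _×_; _,_; proj₁; proj₂)
open import Data.Rational.Base as ℚ using (ℚ; mkℚ; 0ℚ; 1ℚ; _/_; NonNegative; Positive)
import Data.Rational.Properties as ℚ
open import Data.Rational.Solver using (module +-*-Solver)
open import Data.Rational.Unnormalised.Base as ℚᵘ using (mkℚᵘ; *≤*; *≡*)
import Data.Rational.Unnormalised.Properties as ℚᵘ
open import Data.Sum.Base using (inj₁; inj₂)
open import Data.Vec.Base using (tabulate)
open import Relation.Binary.PropositionalEquality
open import Relation.Nullary.Decidable using (does)

-- Giving the out-neighbourhood of each vertex as a set rules out parallel
-- arcs; arcs uv and vu may both be present.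
record Digraph (n : ℕ) : Set where
  field
    outNbrs  : Fin n → Subset n
    loopless : ∀ v → v ∉ outNbrs v

  outdegree : Fin n → ℕ
  outdegree v = ∣ outNbrs v ∣

  IsMinOutdegree : ℕ → Set
  IsMinOutdegree δ = (∀ v → δ ℕ.≤ outdegree v) × (∃[ v ] outdegree v ≡ δ)

3-Colouring : ℕ → Set
3-Colouring n = Fin n → Fin 3

colourClass : ∀ {n} → 3-Colouring n → Fin 3 → Subset n
colourClass f c = tabulate λ u → does (f u Fin.≟ c)

module _ {n} (G : Digraph n) (f : 3-Colouring n) where
  open Digraph G

  AtMostHalf : Fin n → Fin 3 → Set
  AtMostHalf v c = 2 ℕ.* ∣ outNbrs v ∩ colourClass f c ∣ ℕ.≤ outdegree v

  IsMajority : Set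
  IsMajority = ∀ v → AtMostHalf v (f v)

IsCauchy : (ℕ → ℚ) → Set
IsCauchy x = ∀ ε → 0ℚ ℚ.< ε →
  ∃[ N ] (∀ i j → N ℕ.≤ i → N ℕ.≤ j → ℚ.∣ x i ℚ.- x j ∣ ℚ.≤ ε)

record ℝ : Set where
  constructor mkℝ
  field
    seq    : ℕ → ℚ
    cauchy : IsCauchy seq

open ℝ public

infix 4 _<ᴿ_
_<ᴿ_ : ℝ → ℝ → Set
x <ᴿ y = ∃[ ε ] (0ℚ ℚ.< ε × ∃[ N ] (∀ i → N ℕ.≤ i → seq x i ℚ.+ ε ℚ.≤ seq y i))

fromℚ : ℚ → ℝ
fromℚ q .seq _ = q
fromℚ q .cauchy ε 0<ε = 0 , λ _ _ _ _ →
  subst (ℚ._≤ ε) (cong ℚ.∣_∣ (sym (ℚ.+-inverseʳ q))) (ℚ.<⇒≤ 0<ε)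

fromℕ : ℕ → ℝ
fromℕ n = fromℚ (+ n / 1)

infixr 7 _·_
_·_ : ℚ → ℝ → ℝ
(q · x) .seq i = q ℚ.* seq x i
(q · x) .cauchy ε 0<ε = N , λ i j N≤i N≤j → begin
    ℚ.∣ q ℚ.* seq x i ℚ.- q ℚ.* seq x j ∣
      ≡⟨ cong ℚ.∣_∣ (solve 3 (λ a b c → a :* b :- a :* c := a :* (b :- c)) refl q (seq x i) (seq x j)) ⟩
    ℚ.∣ q ℚ.* (seq x i ℚ.- seq x j) ∣
      ≡⟨ ℚ.∣p*q∣≡∣p∣*∣q∣ q _ ⟩
    ℚ.∣ q ∣ ℚ.* ℚ.∣ seq x i ℚ.- seq x j ∣
      ≤⟨ ℚ.*-monoˡ-≤-nonNeg ℚ.∣ q ∣ (close i j N≤i N≤j) ⟩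
    ℚ.∣ q ∣ ℚ.* ε′
      ≤⟨ ℚ.*-monoʳ-≤-nonNeg ε′ ∣q∣≤s ⟩
    s ℚ.* ε′
      ≡⟨ solve 3 (λ a b c → a :* (b :* c) := (a :* b) :* c) refl s (ℚ.1/ s) ε ⟩
    (s ℚ.* ℚ.1/ s) ℚ.* ε
      ≡⟨ cong (ℚ._* ε) (ℚ.*-inverseʳ s) ⟩
    1ℚ ℚ.* ε
      ≡⟨ ℚ.*-identityˡ ε ⟩
    ε ∎
  where
  open ℚ.≤-Reasoning
  open +-*-Solver
  s = 1ℚ ℚ.+ ℚ.∣ q ∣
  instance
    ∣q∣≥0 : NonNegative ℚ.∣ q ∣
    ∣q∣≥0 = ℚ.∣-∣-nonNeg q
    s>0 : Positive s
    s>0 = ℚ.pos+nonNeg⇒pos 1ℚ ℚ.∣ q ∣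
    s≢0 : ℚ.NonZero s
    s≢0 = ℚ.pos⇒nonZero s
    ε>0 : Positive ε
    ε>0 = ℚ.positive 0<ε
  ε′ = ℚ.1/ s ℚ.* ε
  instance
    1/s>0 : Positive (ℚ.1/ s)
    1/s>0 = ℚ.1/pos⇒pos s
    ε′>0 : Positive ε′
    ε′>0 = ℚ.pos*pos⇒pos (ℚ.1/ s) ε
    ε′≥0 : NonNegative ε′
    ε′≥0 = ℚ.pos⇒nonNeg ε′
  ∣q∣≤s : ℚ.∣ q ∣ ℚ.≤ s
  ∣q∣≤s = subst (ℚ._≤ s) (ℚ.+-identityˡ ℚ.∣ q ∣) (ℚ.+-monoˡ-≤ ℚ.∣ q ∣ (ℚ.<⇒≤ (ℚ.positive⁻¹ 1ℚ)))
  c = cauchy x ε′ (ℚ.positive⁻¹ ε′)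
  N = proj₁ c
  close = proj₂ c

-- 1/a + 1/(a+1) + ⋯ + 1/(a+k-1)
recipSum : (a : ℕ) .{{_ : ℕ.NonZero a}} → ℕ → ℚ
recipSum a zero    = 0ℚ
recipSum a (suc k) = 1ℤ / a ℚ.+ recipSum (suc a) k

-- Splitting [1,m] into (m-1)N intervals of length 1/N, with left endpoints
-- (N+i)/N for i < (m-1)N, the left Riemann sum of 1/t is
--   Σ (1/N) · 1/((N+i)/N) = Σ 1/(N+i).
logSum : (m N : ℕ) .{{_ : ℕ.NonZero N}} → ℚ
logSum m N = recipSum N (ℕ.pred m ℕ.* N)

frac-≤ : ∀ p r q s .{{_ : ℕ.NonZero q}} .{{_ : ℕ.NonZero s}} →
         p ℕ.* s ℕ.≤ r ℕ.* q → + p / q ℚ.≤ + r / s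
frac-≤ p r q@(suc q-1) s@(suc s-1) ps≤rq = ℚ.toℚᵘ-cancel-≤ (begin
  ℚ.toℚᵘ (+ p / q)  ≃⟨ ℚ.toℚᵘ-fromℚᵘ (mkℚᵘ (+ p) q-1) ⟩
  mkℚᵘ (+ p) q-1    ≤⟨ *≤* (subst₂ ℤ._≤_ (ℤ.pos-* p s) (ℤ.pos-* r q) (ℤ.+≤+ ps≤rq)) ⟩
  mkℚᵘ (+ r) s-1    ≃⟨ ℚ.toℚᵘ-fromℚᵘ (mkℚᵘ (+ r) s-1) ⟨
  ℚ.toℚᵘ (+ r / s)  ∎)
  where open ℚᵘ.≤-Reasoning

frac-suc : ∀ k b .{{_ : ℕ.NonZero b}} → + suc k / b ≡ 1ℤ / b ℚ.+ + k / b
frac-suc k b@(suc b-1) = ℚ.toℚᵘ-injective (begin-equality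
  ℚ.toℚᵘ (+ suc k / b)                  ≃⟨ ℚ.toℚᵘ-fromℚᵘ (mkℚᵘ (+ suc k) b-1) ⟩
  mkℚᵘ (+ suc k) b-1                    ≃⟨ *≡* (cong +_ (eq k b)) ⟩
  mkℚᵘ (+ (1 ℕ.* b ℕ.+ k ℕ.* b)) (b-1 ℕ.+ b-1 ℕ.* b)
    ≡⟨ cong (λ z → mkℚᵘ z (b-1 ℕ.+ b-1 ℕ.* b)) (cong₂ ℤ._+_ (ℤ.pos-* 1 b) (ℤ.pos-* k b)) ⟩
  mkℚᵘ 1ℤ b-1 ℚᵘ.+ mkℚᵘ (+ k) b-1
    ≃⟨ ℚᵘ.+-cong (ℚ.toℚᵘ-fromℚᵘ (mkℚᵘ 1ℤ b-1)) (ℚ.toℚᵘ-fromℚᵘ (mkℚᵘ (+ k) b-1)) ⟨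
  ℚ.toℚᵘ (1ℤ / b) ℚᵘ.+ ℚ.toℚᵘ (+ k / b) ≃⟨ ℚ.toℚᵘ-homo-+ (1ℤ / b) (+ k / b) ⟨
  ℚ.toℚᵘ (1ℤ / b ℚ.+ + k / b)           ∎)
  where
  open ℚᵘ.≤-Reasoning
  eq : ∀ k b → suc k ℕ.* (b ℕ.* b) ≡ (1 ℕ.* b ℕ.+ k ℕ.* b) ℕ.* b
  eq = ℕ-Solver.solve-∀

recipSum-split : ∀ a j k {c} .{{_ : ℕ.NonZero a}} .{{_ : ℕ.NonZero c}} → c ≡ j ℕ.+ a →
                 recipSum a (j ℕ.+ k) ≡ recipSum a j ℚ.+ recipSum c k
recipSum-split a zero    k refl = sym (ℚ.+-identityˡ _)
recipSum-split a (suc j) k refl = trans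
  (cong (1ℤ / a ℚ.+_) (recipSum-split (suc a) j k (sym (ℕ.+-suc j a))))
  (sym (ℚ.+-assoc (1ℤ / a) (recipSum (suc a) j) _))

recipSum-≤ : ∀ b k .{{_ : ℕ.NonZero b}} → recipSum b k ℚ.≤ + k / b
recipSum-≤ b zero    = frac-≤ 0 0 1 b ℕ.z≤n
recipSum-≤ b (suc k) = begin
  1ℤ / b ℚ.+ recipSum (suc b) k
    ≤⟨ ℚ.+-monoʳ-≤ (1ℤ / b) (recipSum-≤ (suc b) k) ⟩
  1ℤ / b ℚ.+ + k / suc b
    ≤⟨ ℚ.+-monoʳ-≤ (1ℤ / b) (frac-≤ k k (suc b) b (ℕ.*-monoʳ-≤ k (ℕ.n≤1+n b))) ⟩
  1ℤ / b ℚ.+ + k / b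
    ≡⟨ frac-suc k b ⟨
  + suc k / b ∎
  where open ℚ.≤-Reasoning

recipSum-≥ : ∀ b k {c} .{{_ : ℕ.NonZero b}} .{{_ : ℕ.NonZero c}} → c ≡ k ℕ.+ b →
             + k / c ℚ.≤ recipSum b k
recipSum-≥ b zero    {c} refl = frac-≤ 0 0 c 1 ℕ.z≤n
recipSum-≥ b (suc k) {c} refl = begin
  + suc k / c             ≡⟨ frac-suc k c ⟩
  1ℤ / c ℚ.+ + k / c      ≤⟨ ℚ.+-mono-≤ (frac-≤ 1 1 c b (ℕ.*-monoʳ-≤ 1 (ℕ.m≤n+m b (suc k))))
                                        (recipSum-≥ (suc b) k (sym (ℕ.+-suc k b))) ⟩
  1ℤ / b ℚ.+ recipSum (suc b) k ∎
  where open ℚ.≤-Reasoning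

recipSum-refine-≤ : ∀ a M k .{{_ : ℕ.NonZero a}} .{{_ : ℕ.NonZero M}} .{{_ : ℕ.NonZero (a ℕ.* M)}} →
                    recipSum (a ℕ.* M) (k ℕ.* M) ℚ.≤ recipSum a k
recipSum-refine-≤ a M zero    = ℚ.≤-refl
recipSum-refine-≤ a M@(suc _) (suc k) = begin
  recipSum (a ℕ.* M) (M ℕ.+ k ℕ.* M)
    ≡⟨ recipSum-split (a ℕ.* M) M (k ℕ.* M) refl ⟩
  recipSum (a ℕ.* M) M ℚ.+ recipSum (suc a ℕ.* M) (k ℕ.* M)
    ≤⟨ ℚ.+-mono-≤ (recipSum-≤ (a ℕ.* M) M) (recipSum-refine-≤ (suc a) M k) ⟩
  + M / (a ℕ.* M) ℚ.+ recipSum (suc a) k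
    ≤⟨ ℚ.+-monoˡ-≤ _ (frac-≤ M 1 (a ℕ.* M) a (ℕ.≤-reflexive (eq M a))) ⟩
  1ℤ / a ℚ.+ recipSum (suc a) k ∎
  where
  open ℚ.≤-Reasoning
  eq : ∀ M a → M ℕ.* a ≡ 1 ℕ.* (a ℕ.* M)
  eq = ℕ-Solver.solve-∀

recipSum-refine-≥ : ∀ a M k .{{_ : ℕ.NonZero a}} .{{_ : ℕ.NonZero M}} .{{_ : ℕ.NonZero (a ℕ.* M)}} →
                    recipSum (suc a) k ℚ.≤ recipSum (a ℕ.* M) (k ℕ.* M)
recipSum-refine-≥ a M zero    = ℚ.≤-refl
recipSum-refine-≥ a M@(suc _) (suc k) = begin
  1ℤ / suc a ℚ.+ recipSum (suc (suc a)) k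
    ≤⟨ ℚ.+-mono-≤ (ℚ.≤-trans (frac-≤ 1 M (suc a) (suc a ℕ.* M) (ℕ.≤-reflexive (eq M (suc a))))
                             (recipSum-≥ (a ℕ.* M) M refl))
                  (recipSum-refine-≥ (suc a) M k) ⟩
  recipSum (a ℕ.* M) M ℚ.+ recipSum (suc a ℕ.* M) (k ℕ.* M)
    ≡⟨ recipSum-split (a ℕ.* M) M (k ℕ.* M) refl ⟨
  recipSum (a ℕ.* M) (M ℕ.+ k ℕ.* M) ∎
  where
  open ℚ.≤-Reasoning
  eq : ∀ M a → 1 ℕ.* (a ℕ.* M) ≡ M ℕ.* a
  eq = ℕ-Solver.solve-∀

recipSum-shift : ∀ a k .{{_ : ℕ.NonZero a}} → recipSum a k ℚ.≤ recipSum (suc a) k ℚ.+ 1ℤ / a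
recipSum-shift a zero    = ℚ.≤-trans (frac-≤ 0 1 1 a ℕ.z≤n) (ℚ.≤-reflexive (sym (ℚ.+-identityˡ _)))
recipSum-shift a (suc k) = begin
  1ℤ / a ℚ.+ recipSum (suc a) k
    ≤⟨ ℚ.+-monoʳ-≤ (1ℤ / a) (recipSum-shift (suc a) k) ⟩
  1ℤ / a ℚ.+ (recipSum (suc (suc a)) k ℚ.+ 1ℤ / suc a)
    ≡⟨ solve 3 (λ x y z → x :+ (y :+ z) := (z :+ y) :+ x) refl (1ℤ / a) (recipSum (suc (suc a)) k) (1ℤ / suc a) ⟩
  (1ℤ / suc a ℚ.+ recipSum (suc (suc a)) k) ℚ.+ 1ℤ / a ∎
  where
  open ℚ.≤-Reasoning
  open +-*-Solver

logSum-≤ : ∀ m M N .{{_ : ℕ.NonZero M}} .{{_ : ℕ.NonZero N}} → logSum m M ℚ.≤ logSum m N ℚ.+ 1ℤ / M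
logSum-≤ m M@(suc _) N@(suc _) = begin
  recipSum M (p ℕ.* M)
    ≤⟨ recipSum-shift M (p ℕ.* M) ⟩
  recipSum (suc M) (p ℕ.* M) ℚ.+ 1ℤ / M
    ≤⟨ ℚ.+-monoˡ-≤ (1ℤ / M) (recipSum-refine-≥ M N (p ℕ.* M)) ⟩
  recipSum (M ℕ.* N) (p ℕ.* M ℕ.* N) ℚ.+ 1ℤ / M
    ≡⟨ cong (ℚ._+ 1ℤ / M) (recipSum-cong (ℕ.*-comm M N) (eq p M N)) ⟩
  recipSum (N ℕ.* M) (p ℕ.* N ℕ.* M) ℚ.+ 1ℤ / M
    ≤⟨ ℚ.+-monoˡ-≤ (1ℤ / M) (recipSum-refine-≤ N M (p ℕ.* N)) ⟩
  recipSum N (p ℕ.* N) ℚ.+ 1ℤ / M ∎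
  where
  open ℚ.≤-Reasoning
  p = ℕ.pred m
  eq : ∀ p M N → p ℕ.* M ℕ.* N ≡ p ℕ.* N ℕ.* M
  eq = ℕ-Solver.solve-∀
  recipSum-cong : ∀ {a b j k} .{{_ : ℕ.NonZero a}} .{{_ : ℕ.NonZero b}} →
                  a ≡ b → j ≡ k → recipSum a j ≡ recipSum b k
  recipSum-cong refl refl = refl

1/-small : ∀ ε → 0ℚ ℚ.< ε → ∃[ N ] (∀ i → N ℕ.≤ i → 1ℤ / suc i ℚ.≤ ε)
1/-small (mkℚ (+ zero)  d _) (ℚ.*<* (ℤ.+<+ ()))
1/-small (mkℚ -[1+ _ ]  d _) (ℚ.*<* ())
1/-small ε@(mkℚ (+ suc p) d _) _ = d , λ i d≤i →
  subst (1ℤ / suc i ℚ.≤_) (ℚ.fromℚᵘ-toℚᵘ ε)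
    (frac-≤ 1 (suc p) (suc i) (suc d) (ℕ.≤-trans (ℕ.≤-reflexive (ℕ.*-identityˡ (suc d)))
                            (ℕ.≤-trans (ℕ.s≤s d≤i) (ℕ.m≤n*m (suc i) (suc p)))))

-- ∫₁ᵐ dt/t, with i+1 subintervals per unit length at stage i.
log : (m : ℕ) .{{_ : ℕ.NonZero m}} → ℝ
log m .seq i = logSum m (suc i)
log m .cauchy ε 0<ε = N , λ i j N≤i N≤j → ∣-∣≤ (bound i j N≤i) (bound j i N≤j)
  where
  s = 1/-small ε 0<ε
  N = proj₁ s
  small = proj₂ s
  bound : ∀ i j → N ℕ.≤ i → logSum m (suc i) ℚ.≤ logSum m (suc j) ℚ.+ ε
  bound i j N≤i = ℚ.≤-trans (logSum-≤ m (suc i) (suc j)) (ℚ.+-monoʳ-≤ (logSum m (suc j)) (small i N≤i))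
  sub : ∀ {x y} → x ℚ.≤ y ℚ.+ ε → x ℚ.- y ℚ.≤ ε
  sub {x} {y} x≤y+ε = subst (x ℚ.- y ℚ.≤_)
    (solve 2 (λ y e → y :+ e :- y := e) refl y ε) (ℚ.+-monoˡ-≤ (ℚ.- y) x≤y+ε)
    where open +-*-Solver
  ∣-∣≤ : ∀ {x y} → x ℚ.≤ y ℚ.+ ε → y ℚ.≤ x ℚ.+ ε → ℚ.∣ x ℚ.- y ∣ ℚ.≤ ε
  ∣-∣≤ {x} {y} x≤ y≤ with ℚ.∣p∣≡p∨∣p∣≡-p (x ℚ.- y)
  ... | inj₁ eq = subst (ℚ._≤ ε) (sym eq) (sub x≤)
  ... | inj₂ eq = subst (ℚ._≤ ε)
    (sym (trans eq (solve 2 (λ x y → :- (x :- y) := y :- x) refl x y))) (sub y≤)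
    where open +-*-Solver

-- Colour uniformly at random. For a vertex of outdegree d, put h = ⌊d/2⌋ and
-- let X be the number of its out-neighbours of a given colour. Then
-- E 2^X = (4/3)^d, so by Markov's inequality P(X > h) < (4/3)^d / 2^h, which is
-- at most about (8/9)^h. A union bound over the 3n pairs (vertex, colour)
-- succeeds once 6n · 8^h ≤ 9^h. If 2^k ≤ 3n < 2^(k+1), then log (3n) ≥ k/2 by
-- the comparison of ∫ dt/t on dyadic intervals, so the hypothesis yields
-- h ≥ 18k, and 9^18 ≥ 8 · 8^18 finishes the estimate.
module Submission where

open import Defs
open import Data.Fin.Base using (Fin; zero; suc)
open import Data.Fin.Subset using (Subset; inside; outside; _∩_; ∣_∣)
open import Data.Fin.Subset.Properties using (∣p∣≤n)
open import Data.Integer.Base as ℤ using (+_; 1ℤ)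
import Data.Integer.Properties as ℤ
open import Data.Nat.Base using (ℕ; zero; suc; NonZero; >-nonZero; _+_; _*_; _^_; _∸_; _≤_; _<_; z≤n; s≤s; ⌊_/2⌋)
open import Data.Nat.Properties
open import Data.Nat.Tactic.RingSolver using (solve-∀)
open import Data.Product.Base using (∃-syntax; _×_; _,_; proj₁; proj₂; map₂)
open import Data.Rational.Base as ℚ using (0ℚ; _/_)
import Data.Rational.Properties as ℚ
open import Data.Rational.Unnormalised.Base as ℚᵘ using (mkℚᵘ; *≡*)
import Data.Rational.Unnormalised.Properties as ℚᵘ
open import Data.Sum.Base using (_⊎_; inj₁; inj₂)
import Data.Sum.Base as Sum
open import Data.Vec.Base using ([]; _∷_)
import Data.Vec.Functional as Vector
open import Relation.Binary.PropositionalEquality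
open import Relation.Nullary.Decidable using (yes; no; from-yes)
open import Relation.Nullary.Negation using (contradiction)
open import Algebra.Properties.Semiring.Sum +-*-semiring
  using (sum; sum-syntax; sum-cong-≗; ∑-comm; *-distribˡ-sum)

-- Sums over all colourings

-- This is `3 ^ n` times the expectation under a uniform random colouring, kept in ℕ to avoid
-- division. Recursing on the colour of the first vertex lets `colourClass (a Vector.∷ f) c`
-- compute.
total : ∀ {n} → (3-Colouring n → ℕ) → ℕ
total {zero}  F = F λ ()
total {suc n} F = ∑[ a < 3 ] total λ f → F (a Vector.∷ f)

total-*ˡ : ∀ {n} k (F : 3-Colouring n → ℕ) → total (λ f → k * F f) ≡ k * total F
total-*ˡ {zero}  k F = refl
total-*ˡ {suc n} k F = trans
  (sum-cong-≗ λ a → total-*ˡ k λ f → F (a Vector.∷ f))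
  (sym (*-distribˡ-sum k λ a → total λ f → F (a Vector.∷ f)))

total-∑ : ∀ {n} k (F : Fin k → 3-Colouring n → ℕ) →
          total (λ f → ∑[ i < k ] F i f) ≡ ∑[ i < k ] total (F i)
total-∑ {zero}  k F = refl
total-∑ {suc n} k F = trans
  (sum-cong-≗ λ a → total-∑ k λ i f → F i (a Vector.∷ f))
  (∑-comm λ a i → total λ f → F i (a Vector.∷ f))

∑-min : ∀ {k} (t : Fin (suc k) → ℕ) → ∃[ i ] suc k * t i ≤ sum t
∑-min {zero}  t = zero , ≤-refl
∑-min {suc k} t with ∑-min (λ i → t (suc i))
... | i , le with ≤-total (t zero) (t (suc i))
...   | inj₁ t₀≤tᵢ = zero , +-monoʳ-≤ (t zero) (≤-trans (*-monoʳ-≤ (suc k) t₀≤tᵢ) le)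
...   | inj₂ tᵢ≤t₀ = suc i , +-mono-≤ tᵢ≤t₀ le

∑-max : ∀ {k} (t : Fin (suc k) → ℕ) → ∃[ i ] sum t ≤ suc k * t i
∑-max {zero}  t = zero , ≤-refl
∑-max {suc k} t with ∑-max (λ i → t (suc i))
... | i , le with ≤-total (t zero) (t (suc i))
...   | inj₁ t₀≤tᵢ = suc i , +-mono-≤ t₀≤tᵢ le
...   | inj₂ tᵢ≤t₀ = zero , +-monoʳ-≤ (t zero) (≤-trans le (*-monoʳ-≤ (suc k) tᵢ≤t₀))

term≤∑ : ∀ {k} (t : Fin k → ℕ) i → t i ≤ sum t
term≤∑ t zero    = m≤m+n (t zero) _
term≤∑ t (suc i) = ≤-trans (term≤∑ (λ j → t (suc j)) i) (m≤n+m _ (t zero))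

-- Method of conditional expectations: the vertices are coloured one at a time, each with a colour
-- that minimises the total over the remaining choices.
below-average : ∀ {n} (F : 3-Colouring n → ℕ) → ∃[ f ] 3 ^ n * F f ≤ total F
below-average {zero}  F = (λ ()) , ≤-reflexive (*-identityˡ _)
below-average {suc n} F with ∑-min (λ a → total λ f → F (a Vector.∷ f))
... | a , 3*total≤ with below-average (λ f → F (a Vector.∷ f))
...   | f , le = a Vector.∷ f , (begin
  3 * 3 ^ n * F _                        ≡⟨ *-assoc 3 (3 ^ n) _ ⟩
  3 * (3 ^ n * F _)                      ≤⟨ *-monoʳ-≤ 3 le ⟩
  3 * total (λ f → F (a Vector.∷ f))     ≤⟨ 3*total≤ ⟩
  total F                                ∎)
  where open ≤-Reasoning

-- E 2^X = (4/3)^|S| for X the number of elements of S of colour c: each element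
-- contributes an independent factor with mean (2 + 1 + 1)/3.
total-2^ : ∀ {n} (S : Subset n) c →
           total (λ f → 2 ^ ∣ S ∩ colourClass f c ∣) * 3 ^ ∣ S ∣ ≡ 4 ^ ∣ S ∣ * 3 ^ n
total-2^ []                    c = refl
total-2^ {suc n} (outside ∷ S) c = begin
  (T + (T + (T + 0))) * 3 ^ ∣ S ∣  ≡⟨ eq T (3 ^ ∣ S ∣) ⟩
  3 * (T * 3 ^ ∣ S ∣)              ≡⟨ cong (3 *_) (total-2^ S c) ⟩
  3 * (4 ^ ∣ S ∣ * 3 ^ n)          ≡⟨ eq′ (4 ^ ∣ S ∣) (3 ^ n) ⟩
  4 ^ ∣ S ∣ * (3 * 3 ^ n)          ∎
  where
  open ≡-Reasoning
  T = total λ f → 2 ^ ∣ S ∩ colourClass f c ∣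
  eq : ∀ t p → (t + (t + (t + 0))) * p ≡ 3 * (t * p)
  eq = solve-∀
  eq′ : ∀ p q → 3 * (p * q) ≡ p * (3 * q)
  eq′ = solve-∀
total-2^ {suc n} (inside ∷ S) c = begin
  total (λ f → 2 ^ ∣ (inside ∷ S) ∩ colourClass f c ∣) * (3 * 3 ^ ∣ S ∣)
                                   ≡⟨ cong (_* (3 * 3 ^ ∣ S ∣)) (first c) ⟩
  4 * T c * (3 * 3 ^ ∣ S ∣)        ≡⟨ eq (T c) (3 ^ ∣ S ∣) ⟩
  12 * (T c * 3 ^ ∣ S ∣)           ≡⟨ cong (12 *_) (total-2^ S c) ⟩
  12 * (4 ^ ∣ S ∣ * 3 ^ n)         ≡⟨ eq′ (4 ^ ∣ S ∣) (3 ^ n) ⟩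
  4 * 4 ^ ∣ S ∣ * (3 * 3 ^ n)      ∎
  where
  open ≡-Reasoning
  W : Fin 3 → 3-Colouring n → ℕ
  W c f = 2 ^ ∣ S ∩ colourClass f c ∣
  T : Fin 3 → ℕ
  T c = total (W c)
  eq : ∀ t p → 4 * t * (3 * p) ≡ 12 * (t * p)
  eq = solve-∀
  eq′ : ∀ p q → 12 * (p * q) ≡ 4 * p * (3 * q)
  eq′ = solve-∀
  s₀ : ∀ t → 2 * t + (t + (t + 0)) ≡ 4 * t
  s₀ = solve-∀
  s₁ : ∀ t → t + (2 * t + (t + 0)) ≡ 4 * t
  s₁ = solve-∀
  s₂ : ∀ t → t + (t + (2 * t + 0)) ≡ 4 * t
  s₂ = solve-∀
  -- Exactly one of the three colours of the new vertex equals `c`, and there the weight doubles.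
  -- Splitting on `c` makes the colour comparisons reduce, which shows which summand that is.
  first : ∀ c → total (λ f → 2 ^ ∣ (inside ∷ S) ∩ colourClass f c ∣) ≡ 4 * T c
  first c@zero             = trans (cong (λ u → u + (T c + (T c + 0))) (total-*ˡ 2 (W c))) (s₀ (T c))
  first c@(suc zero)       = trans (cong (λ u → T c + (u + (T c + 0))) (total-*ˡ 2 (W c))) (s₁ (T c))
  first c@(suc (suc zero)) = trans (cong (λ u → T c + (T c + (u + 0))) (total-*ˡ 2 (W c))) (s₂ (T c))

-- Numerical estimates

^-distribʳ-* : ∀ n a b → (a * b) ^ n ≡ a ^ n * b ^ n
^-distribʳ-* zero    a b = refl
^-distribʳ-* (suc n) a b = trans (cong (a * b *_) (^-distribʳ-* n a b)) (eq a b (a ^ n) (b ^ n))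
  where
  eq : ∀ a b x y → a * b * (x * y) ≡ a * x * (b * y)
  eq = solve-∀

≡2*⌊n/2⌋⊎≡1+2*⌊n/2⌋ : ∀ n → n ≡ 2 * ⌊ n /2⌋ ⊎ n ≡ suc (2 * ⌊ n /2⌋)
≡2*⌊n/2⌋⊎≡1+2*⌊n/2⌋ 0             = inj₁ refl
≡2*⌊n/2⌋⊎≡1+2*⌊n/2⌋ 1             = inj₂ refl
≡2*⌊n/2⌋⊎≡1+2*⌊n/2⌋ (suc (suc n)) =
  Sum.map (λ e → trans (cong (λ x → 2 + x) e) (sym (*-suc 2 ⌊ n /2⌋)))
          (λ e → trans (cong (λ x → 2 + x) e) (cong suc (sym (*-suc 2 ⌊ n /2⌋))))
          (≡2*⌊n/2⌋⊎≡1+2*⌊n/2⌋ n)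

2*⌊n/2⌋≤n : ∀ n → 2 * ⌊ n /2⌋ ≤ n
2*⌊n/2⌋≤n n with ≡2*⌊n/2⌋⊎≡1+2*⌊n/2⌋ n
... | inj₁ e = ≤-reflexive (sym e)
... | inj₂ e = subst (2 * ⌊ n /2⌋ ≤_) (sym e) (n≤1+n _)

4^[2*h] : ∀ h → 4 ^ (2 * h) ≡ 2 ^ h * 8 ^ h
4^[2*h] h = trans (sym (^-*-assoc 4 2 h)) (^-distribʳ-* h 2 8)

-- For `d = 2 * h` the claim is `m * 8 ^ h ≤ 9 ^ h` after cancelling `2 ^ h`, and the hypothesis has
-- a factor 2 to spare. An odd `d` brings a further 4 on the left and 3 on the right: that 4 splits
-- into the 2 of the hypothesis and a 2 bounded by 3.
m*4^d≤2^⌊d/2⌋*3^d : ∀ m d → 2 * m * 8 ^ ⌊ d /2⌋ ≤ 9 ^ ⌊ d /2⌋ → m * 4 ^ d ≤ 2 ^ ⌊ d /2⌋ * 3 ^ d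
m*4^d≤2^⌊d/2⌋*3^d m d le with ≡2*⌊n/2⌋⊎≡1+2*⌊n/2⌋ d
... | inj₁ e = begin
  m * 4 ^ d              ≡⟨ cong (λ x → m * 4 ^ x) e ⟩
  m * 4 ^ (2 * h)        ≡⟨ cong (m *_) (4^[2*h] h) ⟩
  m * (2 ^ h * 8 ^ h)    ≡⟨ eq m (2 ^ h) (8 ^ h) ⟩
  2 ^ h * (m * 8 ^ h)    ≤⟨ *-monoʳ-≤ (2 ^ h) (*-monoˡ-≤ (8 ^ h) (m≤n*m m 2)) ⟩
  2 ^ h * (2 * m * 8 ^ h) ≤⟨ *-monoʳ-≤ (2 ^ h) le ⟩
  2 ^ h * 9 ^ h          ≡⟨ cong (2 ^ h *_) (^-*-assoc 3 2 h) ⟩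
  2 ^ h * 3 ^ (2 * h)    ≡⟨ cong (λ x → 2 ^ h * 3 ^ x) e ⟨
  2 ^ h * 3 ^ d          ∎
  where
  open ≤-Reasoning
  h = ⌊ d /2⌋
  eq : ∀ m a b → m * (a * b) ≡ a * (m * b)
  eq = solve-∀
... | inj₂ e = begin
  m * 4 ^ d                          ≡⟨ cong (λ x → m * 4 ^ x) e ⟩
  m * (4 * 4 ^ (2 * h))              ≡⟨ cong (λ x → m * (4 * x)) (4^[2*h] h) ⟩
  m * (4 * (2 ^ h * 8 ^ h))          ≡⟨ eq m (2 ^ h) (8 ^ h) ⟩
  2 ^ h * (2 * (2 * m * 8 ^ h))      ≤⟨ *-monoʳ-≤ (2 ^ h) (*-mono-≤ (n≤1+n 2) le) ⟩
  2 ^ h * (3 * 9 ^ h)                ≡⟨ cong (λ x → 2 ^ h * (3 * x)) (^-*-assoc 3 2 h) ⟩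
  2 ^ h * (3 * 3 ^ (2 * h))          ≡⟨ cong (λ x → 2 ^ h * 3 ^ x) e ⟨
  2 ^ h * 3 ^ d                      ∎
  where
  open ≤-Reasoning
  h = ⌊ d /2⌋
  eq : ∀ m a b → m * (4 * (a * b)) ≡ a * (2 * (2 * m * b))
  eq = solve-∀

-- `2 ≤ m` forces `k ≥ 1`, so `2 * m ≤ 2 ^ (2 + k) ≤ 8 ^ k`. Each of these `k` factors 8 is absorbed
-- by 18 factors 9/8, and the remaining `r` factors 9/8 only help.
2*m*8^h≤9^h : ∀ {m k h} → 2 ≤ m → m < 2 ^ suc k → 18 * k ≤ h → 2 * m * 8 ^ h ≤ 9 ^ h
2*m*8^h≤9^h {m} {zero}      2≤m m<2 _ = contradiction 2≤m (<⇒≱ m<2)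
2*m*8^h≤9^h {m} {k@(suc j)} {h} _ m<2^1+k 18k≤h = begin
  2 * m * 8 ^ h                        ≡⟨ cong (λ x → 2 * m * 8 ^ x) h≡ ⟩
  2 * m * 8 ^ (18 * k + r)             ≡⟨ cong (2 * m *_) (^-distribˡ-+-* 8 (18 * k) r) ⟩
  2 * m * (8 ^ (18 * k) * 8 ^ r)       ≤⟨ *-monoˡ-≤ _ 2m≤8^k ⟩
  8 ^ k * (8 ^ (18 * k) * 8 ^ r)       ≡⟨ *-assoc (8 ^ k) (8 ^ (18 * k)) (8 ^ r) ⟨
  8 ^ k * 8 ^ (18 * k) * 8 ^ r         ≡⟨ cong (λ x → 8 ^ k * x * 8 ^ r) (^-*-assoc 8 18 k) ⟨
  8 ^ k * (8 ^ 18) ^ k * 8 ^ r         ≡⟨ cong (_* 8 ^ r) (^-distribʳ-* k 8 (8 ^ 18)) ⟨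
  (8 ^ 19) ^ k * 8 ^ r                 ≤⟨ *-mono-≤ (^-monoˡ-≤ k 8^19≤9^18) (^-monoˡ-≤ r (n≤1+n 8)) ⟩
  (9 ^ 18) ^ k * 9 ^ r                 ≡⟨ cong (_* 9 ^ r) (^-*-assoc 9 18 k) ⟩
  9 ^ (18 * k) * 9 ^ r                 ≡⟨ ^-distribˡ-+-* 9 (18 * k) r ⟨
  9 ^ (18 * k + r)                     ≡⟨ cong (9 ^_) h≡ ⟨
  9 ^ h                                ∎
  where
  open ≤-Reasoning
  r = h ∸ 18 * k
  h≡ : h ≡ 18 * k + r
  h≡ = sym (m+[n∸m]≡n 18k≤h)
  -- 18 is the least `e` with `8 ^ (1 + e) ≤ 9 ^ e`. The constant 72 is 2 · 2 · 18: one 2 comes from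
  -- halving the outdegree, the other from log (2^k) ≥ k/2.
  8^19≤9^18 : 8 ^ 19 ≤ 9 ^ 18
  8^19≤9^18 = from-yes (8 ^ 19 ≤? 9 ^ 18)
  k+2≤3k : 2 + k ≤ 3 * k
  k+2≤3k = subst (2 + k ≤_) (eq j) (m≤m+n (2 + k) (2 * j))
    where
    eq : ∀ j → 2 + suc j + 2 * j ≡ 3 * suc j
    eq = solve-∀
  2m≤8^k : 2 * m ≤ 8 ^ k
  2m≤8^k = begin
    2 * m          ≤⟨ *-monoʳ-≤ 2 (<⇒≤ m<2^1+k) ⟩
    2 ^ (2 + k)    ≤⟨ ^-monoʳ-≤ 2 k+2≤3k ⟩
    2 ^ (3 * k)    ≡⟨ ^-*-assoc 2 3 k ⟨
    8 ^ k          ∎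

2^-cancel-≤ : ∀ {a b} → 2 ^ a ≤ 2 ^ b → a ≤ b
2^-cancel-≤ 2^a≤2^b = ≮⇒≥ λ b<a → <⇒≱ (^-monoʳ-< 2 ≤-refl b<a) 2^a≤2^b

-- Lower bound for the logarithm

dyadic : ∀ m → .{{NonZero m}} → ∃[ k ] (2 ^ k ≤ m × m < 2 ^ suc k)
dyadic 1 = 0 , ≤-refl , ≤-refl
dyadic (suc m@(suc _)) with dyadic m
... | k , 2^k≤m , m<2^1+k with suc m <? 2 ^ suc k
...   | yes 1+m<2^1+k = k , m≤n⇒m≤1+n 2^k≤m , 1+m<2^1+k
...   | no  1+m≮2^1+k = suc k , ≮⇒≥ 1+m≮2^1+k ,
  ≤-<-trans m<2^1+k (^-monoʳ-< 2 ≤-refl (n<1+n (suc k)))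

recipSum-nonNeg : ∀ a k .{{_ : NonZero a}} → 0ℚ ℚ.≤ recipSum a k
recipSum-nonNeg a zero      = ℚ.≤-refl
recipSum-nonNeg a k@(suc _) = ℚ.≤-trans (frac-≤ 0 k 1 (k + a) z≤n) (recipSum-≥ a k refl)

recipSum-monoʳ-≤ : ∀ a {j k} .{{_ : NonZero a}} → j ≤ k → recipSum a j ℚ.≤ recipSum a k
recipSum-monoʳ-≤ a@(suc _) {j} {k} j≤k = begin
  recipSum a j                                   ≡⟨ ℚ.+-identityʳ _ ⟨
  recipSum a j ℚ.+ 0ℚ                            ≤⟨ ℚ.+-monoʳ-≤ (recipSum a j) (recipSum-nonNeg (j + a) (k ∸ j)) ⟩
  recipSum a j ℚ.+ recipSum (j + a) (k ∸ j)      ≡⟨ recipSum-split a j (k ∸ j) refl ⟨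
  recipSum a (j + (k ∸ j))                       ≡⟨ cong (recipSum a) (m+[n∸m]≡n j≤k) ⟩
  recipSum a k                                   ∎
  where
  open ℚ.≤-Reasoning
  instance
    j+a≢0 : NonZero (j + a)
    j+a≢0 = >-nonZero (<-≤-trans (s≤s z≤n) (m≤n+m a j))

-- ∫ dt/t over [2^k, 2^(k+1)] is at least 1/2.
logSum-2^ : ∀ k N .{{_ : NonZero N}} → + k / 2 ℚ.≤ logSum (2 ^ k) N
logSum-2^ zero    N         = ℚ.≤-refl
logSum-2^ (suc k) N@(suc _) with 2 ^ k | m^n≢0 2 k | logSum-2^ k N
-- Writing `2 ^ k` as `suc q` makes `ℕ.pred` compute: the sum for `2 ^ k` has `q * N` terms and
-- stops just before 1/(pN), where the new block of `p * N` terms begins.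
... | p@(suc q) | _ | ih = begin
  + suc k / 2                                ≡⟨ frac-suc k 2 ⟩
  1ℤ / 2 ℚ.+ + k / 2                         ≤⟨ ℚ.+-mono-≤ half ih ⟩
  recipSum (p * N) (p * N) ℚ.+ recipSum N (q * N)
                                             ≡⟨ ℚ.+-comm (recipSum (p * N) (p * N)) _ ⟩
  recipSum N (q * N) ℚ.+ recipSum (p * N) (p * N)
                                             ≡⟨ recipSum-split N (q * N) (p * N) (+-comm N (q * N)) ⟨
  recipSum N (q * N + p * N)                 ≡⟨ cong (recipSum N) (eq q N) ⟩
  recipSum N ((q + (p + 0)) * N)             ∎
  where
  open ℚ.≤-Reasoning
  eq : ∀ q N → q * N + suc q * N ≡ (q + (suc q + 0)) * N
  eq = solve-∀
  eq′ : ∀ x → 1 * (x + x) ≡ x * 2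
  eq′ = solve-∀
  -- All `p * N` terms are at least 1/(2pN).
  half : 1ℤ / 2 ℚ.≤ recipSum (p * N) (p * N)
  half = ℚ.≤-trans (frac-≤ 1 (p * N) 2 (p * N + p * N) (≤-reflexive (eq′ (p * N))))
                   (recipSum-≥ (p * N) (p * N) refl)

/1-cancel-≤ : ∀ {a b} → + a / 1 ℚ.≤ + b / 1 → a ≤ b
/1-cancel-≤ {a} {b} a≤b = ℤ.drop‿+≤+ (subst₂ ℤ._≤_ (ℤ.*-identityʳ (+ a)) (ℤ.*-identityʳ (+ b))
  (ℚᵘ.drop-*≤* (begin
    mkℚᵘ (+ a) 0        ≃⟨ ℚ.toℚᵘ-fromℚᵘ (mkℚᵘ (+ a) 0) ⟨
    ℚ.toℚᵘ (+ a / 1)    ≤⟨ ℚ.toℚᵘ-mono-≤ a≤b ⟩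
    ℚ.toℚᵘ (+ b / 1)    ≃⟨ ℚ.toℚᵘ-fromℚᵘ (mkℚᵘ (+ b) 0) ⟩
    mkℚᵘ (+ b) 0        ∎)))
  where open ℚᵘ.≤-Reasoning

72*k/2 : ∀ k → + (36 * k) / 1 ≡ + 72 / 1 ℚ.* (+ k / 2)
72*k/2 k = ℚ.toℚᵘ-injective (begin-equality
  ℚ.toℚᵘ (+ (36 * k) / 1)                       ≃⟨ ℚ.toℚᵘ-fromℚᵘ (mkℚᵘ (+ (36 * k)) 0) ⟩
  mkℚᵘ (+ (36 * k)) 0                           ≃⟨ *≡* eqℤ ⟩
  mkℚᵘ (+ 72) 0 ℚᵘ.* mkℚᵘ (+ k) 1               ≃⟨ ℚᵘ.*-cong (ℚᵘ.≃-refl {mkℚᵘ (+ 72) 0}) (ℚ.toℚᵘ-fromℚᵘ (mkℚᵘ (+ k) 1)) ⟨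
  ℚ.toℚᵘ (+ 72 / 1) ℚᵘ.* ℚ.toℚᵘ (+ k / 2)       ≃⟨ ℚ.toℚᵘ-homo-* (+ 72 / 1) (+ k / 2) ⟨
  ℚ.toℚᵘ (+ 72 / 1 ℚ.* (+ k / 2))               ∎)
  where
  open ℚᵘ.≤-Reasoning
  eq : ∀ k → 36 * k * 2 ≡ 72 * k * 1
  eq = solve-∀
  eqℤ : + (36 * k) ℤ.* + 2 ≡ + 72 ℤ.* + k ℤ.* + 1
  eqℤ = trans (sym (ℤ.pos-* (36 * k) 2)) (trans (cong +_ (eq k))
        (trans (ℤ.pos-* (72 * k) 1) (cong (ℤ._* + 1) (ℤ.pos-* 72 k))))

-- The bound `k / 2` holds for every Riemann sum, not only in the limit, so it suffices to read the
-- hypothesis at a single stage, the threshold `N` itself.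
72log<δ⇒36k≤δ : ∀ {m k δ} .{{_ : NonZero m}} → 2 ^ k ≤ m →
                ((+ 72 / 1) · log m) <ᴿ fromℕ δ → 36 * k ≤ δ
72log<δ⇒36k≤δ {m} {k} {δ} 2^k≤m (ε , 0<ε , N , 72log+ε≤δ) = /1-cancel-≤ (begin
  + (36 * k) / 1                     ≡⟨ 72*k/2 k ⟩
  + 72 / 1 ℚ.* (+ k / 2)             ≤⟨ ℚ.*-monoˡ-≤-nonNeg (+ 72 / 1) k/2≤log ⟩
  + 72 / 1 ℚ.* logSum m (suc N)      ≡⟨ ℚ.+-identityʳ _ ⟨
  + 72 / 1 ℚ.* logSum m (suc N) ℚ.+ 0ℚ
                                     ≤⟨ ℚ.+-monoʳ-≤ (+ 72 / 1 ℚ.* logSum m (suc N)) (ℚ.<⇒≤ 0<ε) ⟩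
  + 72 / 1 ℚ.* logSum m (suc N) ℚ.+ ε
                                     ≤⟨ 72log+ε≤δ N ≤-refl ⟩
  + δ / 1                            ∎)
  where
  open ℚ.≤-Reasoning
  k/2≤log : + k / 2 ℚ.≤ logSum m (suc N)
  -- Rounding `m` down to `2 ^ k` keeps the mesh and only drops terms from the end of the sum.
  k/2≤log = ℚ.≤-trans (logSum-2^ k (suc N))
    (recipSum-monoʳ-≤ (suc N) (*-monoˡ-≤ (suc N) (pred-mono-≤ 2^k≤m)))

-- The union bound

-- Each of the 3n summands `W v c` of `Φ` has average at most 2^n / (3n), so some colouring has
-- `Φ f ≤ 2 ^ n`. Then every summand is at most `2 ^ n`, and comparing exponents gives
-- `X v c f ≤ h v`.
balanced : ∀ {n} .{{_ : NonZero n}} (G : Digraph n) →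
           (∀ v → let h = ⌊ Digraph.outdegree G v /2⌋ in 2 * (3 * n) * 8 ^ h ≤ 9 ^ h) →
           ∃[ f ] (∀ v c → AtMostHalf G f v c)
balanced {n@(suc _)} G large = map₂ (λ {f} → fits f) (below-average Φ)
  where
  open Digraph G
  h : Fin n → ℕ
  h v = ⌊ outdegree v /2⌋
  -- Guarantees that the truncated subtraction `n ∸ h v` is a true difference.
  h≤n : ∀ v → h v ≤ n
  h≤n v = ≤-trans (⌊n/2⌋≤n (outdegree v)) (∣p∣≤n (outNbrs v))
  -- The factor 2^(n - h) makes every violated constraint contribute more than
  -- 2^n to Φ.
  X : Fin n → Fin 3 → 3-Colouring n → ℕ
  X v c f = ∣ outNbrs v ∩ colourClass f c ∣
  W : Fin n → Fin 3 → 3-Colouring n → ℕ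
  W v c f = 2 ^ (n ∸ h v) * 2 ^ X v c f
  Φ : 3-Colouring n → ℕ
  Φ f = ∑[ v < n ] ∑[ c < 3 ] W v c f

  3n*total-W≤ : ∀ v c → 3 * n * total (W v c) ≤ 3 ^ n * 2 ^ n
  -- The factor `3 ^ d` clears the denominator of (4/3)^d, the form in which `total-2^` gives the
  -- expectation.
  3n*total-W≤ v c = *-cancelʳ-≤ _ _ (3 ^ d) {{m^n≢0 3 d}} (begin
    3 * n * total (W v c) * 3 ^ d      ≡⟨ cong (λ x → 3 * n * x * 3 ^ d) (total-*ˡ w (λ f → 2 ^ X v c f)) ⟩
    3 * n * (w * T) * 3 ^ d            ≡⟨ eq₁ (3 * n) w T (3 ^ d) ⟩
    3 * n * w * (T * 3 ^ d)            ≡⟨ cong (3 * n * w *_) (total-2^ (outNbrs v) c) ⟩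
    3 * n * w * (4 ^ d * 3 ^ n)        ≡⟨ eq₂ (3 * n) w (4 ^ d) (3 ^ n) ⟩
    3 ^ n * w * (3 * n * 4 ^ d)        ≤⟨ *-monoʳ-≤ (3 ^ n * w) (m*4^d≤2^⌊d/2⌋*3^d (3 * n) d (large v)) ⟩
    3 ^ n * w * (2 ^ h v * 3 ^ d)      ≡⟨ eq₃ (3 ^ n) w (2 ^ h v) (3 ^ d) ⟩
    3 ^ n * (w * 2 ^ h v) * 3 ^ d      ≡⟨ cong (λ x → 3 ^ n * x * 3 ^ d) w*2^h≡2^n ⟩
    3 ^ n * 2 ^ n * 3 ^ d              ∎)
    where
    open ≤-Reasoning
    d = outdegree v
    w = 2 ^ (n ∸ h v)
    T = total λ f → 2 ^ X v c f
    eq₁ : ∀ m w t p → m * (w * t) * p ≡ m * w * (t * p)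
    eq₁ = solve-∀
    eq₂ : ∀ m w x y → m * w * (x * y) ≡ y * w * (m * x)
    eq₂ = solve-∀
    eq₃ : ∀ y w z p → y * w * (z * p) ≡ y * (w * z) * p
    eq₃ = solve-∀
    w*2^h≡2^n : w * 2 ^ h v ≡ 2 ^ n
    w*2^h≡2^n = trans (sym (^-distribˡ-+-* 2 (n ∸ h v) (h v))) (cong (2 ^_) (m∸n+n≡m (h≤n v)))

  total-Φ≤ : total Φ ≤ 3 ^ n * 2 ^ n
  -- All pairs obey the same bound, so each sum may be replaced by its number of terms times its
  -- largest term.
  total-Φ≤ with ∑-max (λ v → total λ f → ∑[ c < 3 ] W v c f)
  ... | v , ≤v with ∑-max (λ c → total (W v c))
  ...   | c , ≤c = begin
    total Φ                                        ≡⟨ total-∑ n (λ v f → ∑[ c < 3 ] W v c f) ⟩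
    ∑[ v < n ] total (λ f → ∑[ c < 3 ] W v c f)    ≤⟨ ≤v ⟩
    n * total (λ f → ∑[ c < 3 ] W v c f)           ≡⟨ cong (n *_) (total-∑ 3 (W v)) ⟩
    n * (∑[ c < 3 ] total (W v c))                 ≤⟨ *-monoʳ-≤ n ≤c ⟩
    n * (3 * total (W v c))                        ≡⟨ eq n (total (W v c)) ⟩
    3 * n * total (W v c)                          ≤⟨ 3n*total-W≤ v c ⟩
    3 ^ n * 2 ^ n                                  ∎
    where
    open ≤-Reasoning
    eq : ∀ n t → n * (3 * t) ≡ 3 * n * t
    eq = solve-∀

  fits : ∀ f → 3 ^ n * Φ f ≤ total Φ → ∀ v c → AtMostHalf G f v c
  fits f 3^nΦ≤ v c = ≤-trans (*-monoʳ-≤ 2 X≤h) (2*⌊n/2⌋≤n (outdegree v))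
    where
    open ≤-Reasoning
    2^≤2^n : 2 ^ (n ∸ h v + X v c f) ≤ 2 ^ n
    2^≤2^n = begin
      2 ^ (n ∸ h v + X v c f)    ≡⟨ ^-distribˡ-+-* 2 (n ∸ h v) (X v c f) ⟩
      W v c f                    ≤⟨ term≤∑ (λ c → W v c f) c ⟩
      ∑[ c < 3 ] W v c f         ≤⟨ term≤∑ (λ v → ∑[ c < 3 ] W v c f) v ⟩
      Φ f                        ≤⟨ *-cancelˡ-≤ (3 ^ n) {{m^n≢0 3 n}} (≤-trans 3^nΦ≤ total-Φ≤) ⟩
      2 ^ n                      ∎
    X≤h : X v c f ≤ h v
    X≤h = +-cancelˡ-≤ (n ∸ h v) _ _
      (≤-trans (2^-cancel-≤ 2^≤2^n) (≤-reflexive (sym (m∸n+n≡m (h≤n v)))))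

theorem3 : ∀ (n : ℕ) .{{_ : NonZero n}} (G : Digraph n) (δ : ℕ) →
    Digraph.IsMinOutdegree G δ →
    ((+ 72 / 1) · log (3 * n) {{m*n≢0 3 n}}) <ᴿ fromℕ δ →
    (∃[ f ] IsMajority G f) ×
    (∃[ f ] (IsMajority G f × (∀ v c → AtMostHalf G f v c)))
theorem3 n@(suc _) G δ (δ≤ , _) 72log<δ with dyadic (3 * n)
... | k , 2^k≤3n , 3n<2^1+k = (f , majority) , (f , majority , half)
  where
  18k≤h : ∀ v → 18 * k ≤ ⌊ Digraph.outdegree G v /2⌋
  18k≤h v = begin
    18 * k                             ≡⟨ n≡⌊n+n/2⌋ (18 * k) ⟩
    ⌊ 18 * k + 18 * k /2⌋              ≡⟨ cong ⌊_/2⌋ (*-distribʳ-+ k 18 18) ⟨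
    ⌊ 36 * k /2⌋                       ≤⟨ ⌊n/2⌋-mono (≤-trans (72log<δ⇒36k≤δ {k = k} 2^k≤3n 72log<δ) (δ≤ v)) ⟩
    ⌊ Digraph.outdegree G v /2⌋        ∎
    where open ≤-Reasoning
  2≤3n : 2 ≤ 3 * n
  2≤3n = ≤-trans (n≤1+n 2) (m≤m*n 3 n)
  colouring = balanced G λ v → 2*m*8^h≤9^h {k = k} 2≤3n 3n<2^1+k (18k≤h v)
  f = proj₁ colouring
  half = proj₂ colouring
  majority : IsMajority G f
  majority v = half v (f v)
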